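{- Let $U$ be a nonempty set. Over $U$, general validity is strictly included in standard validity, $\models^d\subsetneq\models^{d'}$: every MSO formula $\varphi$ with $\models^d\varphi$ satisfies $\models^{d'}\varphi$, whereas for a binary relation symbol $P$, a first-order variable $x$ and a monadic variable $X$, the formula $$\exists X.\,\forall x.\,(X(x)\leftrightarrow P(x,x))$$ satisfies $\models^{d'}$ but not $\models^d$.
   Context: **Syntax.** Relation symbols $R=\mathbb N$, first-order variables $V=\mathbb N$ and second-order (monadic) variables $V_2=\mathbb N$ (the two kinds of variables form separate namespaces). MSO formulas: $\varphi,\psi ::= r(x,y)\mid X(x)\mid\neg\varphi\mid\varphi\wedge\psi\mid\exists x.\varphi\mid\exists X.\varphi$ with $r\in R$, $x,y\in V$, $X\in V_2$ (no equality). The connectives $\vee,\supset,\leftrightarrow$ and the universals $\forall x.\varphi:=\neg\exists x.\neg\varphi$, $\forall X.\varphi:=\neg\exists X.\neg\varphi$ are the usual abbreviations. **Semantics.** $U$ is a fixed nonempty set (the type of individuals). An interpretation $I$ over $U$ assigns to each $r\in R$ a binary relation $I(r)\subseteq U\times U$. Given $I$, a set $D\subseteq U$, a family $E\subseteq\mathcal P(U)$ (no closure condition on $E$), and assignments $g:V\to U$, $G:V_2\to\mathcal P(U)$, truth $\langle I,D,E\rangle,g,G\models^d\varphi$ is defined recursively: $r(x,y)$ holds iff $(g(x),g(y))\in I(r)$; $X(x)$ holds iff $g(x)\in G(X)$; $\neg,\wedge$ are classical; $\exists x.\varphi$ holds iff $\langle I,D,E\rangle,g[x\leftarrow d],G\models^d\varphi$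 for some $d\in D$; $\exists X.\varphi$ holds iff $\langle I,D,E\rangle,g,G\langle X\leftarrow S\rangle\models^d\varphi$ for some $S\in E$. Here $g[x\leftarrow d]$ and $G\langle X\leftarrow S\rangle$ are the usual updates. **General validity.** $\models^d\varphi$ means: for all $I$, $D\subseteq U$, $E\subseteq\mathcal P(U)$, all $g$ with $\mathrm{Range}(g)\subseteq D$ and all $G$ with $\mathrm{Range}(G)\subseteq E$, $\langle I,D,E\rangle,g,G\models^d\varphi$. **Standard validity.** $\models^{d'}\varphi$ means: for all $I$, $g:V\to U$, $G:V_2\to\mathcal P(U)$, $\langle I,U,\mathcal P(U)\rangle,g,G\models^d\varphi$. -}

module Defs where

open import Level using (Level; Lift; suc)
open import Data.Bool using (if_then_else_)
open import Data.Nat using (ℕ; _≡ᵇ_)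
open import Data.Product using (_×_; ∃)
open import Data.Unit.Polymorphic using (⊤)
open import Relation.Binary.Core using (Rel)
open import Relation.Binary.Definitions using (_Respects_)
open import Relation.Nullary using (¬_)
open import Relation.Unary using (Pred; _∈_; _≐_)

RelSym Var Var₂ : Set
RelSym = ℕ
Var    = ℕ
Var₂   = ℕ

infix  9 _⟨_⟩ᶠ
infixr 8 ¬ᶠ_
infixr 7 _∧ᶠ_
infixr 6 _∨ᶠ_
infixr 5 _⊃ᶠ_
infix  4 _↔ᶠ_

data Formula : Set where
  rel   : RelSym → Var → Var → Formula
  _⟨_⟩ᶠ : Var₂ → Var → Formula
  ¬ᶠ_   : Formula → Formula
  _∧ᶠ_  : Formula → Formula → Formula
  ∃¹    : Var → Formula → Formula
  ∃²    : Var₂ → Formula → Formula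

_∨ᶠ_ _⊃ᶠ_ _↔ᶠ_ : Formula → Formula → Formula
φ ∨ᶠ ψ = ¬ᶠ (¬ᶠ φ ∧ᶠ ¬ᶠ ψ)
φ ⊃ᶠ ψ = ¬ᶠ φ ∨ᶠ ψ
φ ↔ᶠ ψ = (φ ⊃ᶠ ψ) ∧ᶠ (ψ ⊃ᶠ φ)

∀¹ : Var → Formula → Formula
∀¹ x φ = ¬ᶠ (∃¹ x (¬ᶠ φ))

∀² : Var₂ → Formula → Formula
∀² X φ = ¬ᶠ (∃² X (¬ᶠ φ))

_[_←_] : ∀ {a} {A : Set a} → (ℕ → A) → ℕ → A → (ℕ → A)
(f [ n ← a ]) m = if m ≡ᵇ n then a else f m

module _ {ℓ : Level} (U : Set ℓ) where

  Subset : Set (suc ℓ)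
  Subset = Pred U ℓ

  Family : Set (suc (suc ℓ))
  Family = Pred Subset (suc ℓ)

  Interpretation : Set (suc ℓ)
  Interpretation = RelSym → Rel U ℓ

module _ {ℓ : Level} {U : Set ℓ} where

  -- Tarskian truth, with the object-level connectives and quantifiers read as
  -- those of Agda; no excluded middle is assumed.  Atoms are lifted because
  -- the second-order existential lives one universe above U.
  infix 2 ⟨_,_,_⟩,_,_⊨ᵈ_
  ⟨_,_,_⟩,_,_⊨ᵈ_ : Interpretation U → Subset U → Family U →
                   (Var → U) → (Var₂ → Subset U) → Formula → Set (suc ℓ)
  ⟨ I , D , E ⟩, g , G ⊨ᵈ rel r x y  = Lift (suc ℓ) (I r (g x) (g y))
  ⟨ I , D , E ⟩, g , G ⊨ᵈ X ⟨ x ⟩ᶠ   = Lift (suc ℓ) (g x ∈ G X)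
  ⟨ I , D , E ⟩, g , G ⊨ᵈ (¬ᶠ φ)     = ¬ (⟨ I , D , E ⟩, g , G ⊨ᵈ φ)
  ⟨ I , D , E ⟩, g , G ⊨ᵈ (φ ∧ᶠ ψ)   =
    (⟨ I , D , E ⟩, g , G ⊨ᵈ φ) × (⟨ I , D , E ⟩, g , G ⊨ᵈ ψ)
  ⟨ I , D , E ⟩, g , G ⊨ᵈ ∃¹ x φ     =
    ∃ λ d → d ∈ D × (⟨ I , D , E ⟩, (g [ x ← d ]) , G ⊨ᵈ φ)
  ⟨ I , D , E ⟩, g , G ⊨ᵈ ∃² X φ     =
    ∃ λ S → S ∈ E × (⟨ I , D , E ⟩, g , (G [ X ← S ]) ⊨ᵈ φ)

module _ {ℓ : Level} (U : Set ℓ) where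

  -- Subsets are predicates, identified when they have the same elements; so a
  -- family of subsets is required to respect _≐_.  This is extensionality
  -- only, not a closure condition on the family.
  GenerallyValid : Pred Formula (suc (suc ℓ))
  GenerallyValid φ =
    (I : Interpretation U) (D : Subset U) (E : Family U) → E Respects _≐_ →
    (g : Var → U) → (∀ x → g x ∈ D) →
    (G : Var₂ → Subset U) → (∀ X → G X ∈ E) →
    ⟨ I , D , E ⟩, g , G ⊨ᵈ φ

  StandardlyValid : Pred Formula (suc ℓ)
  StandardlyValid φ =
    (I : Interpretation U) (g : Var → U) (G : Var₂ → Subset U) →
    ⟨ I , (λ _ → ⊤) , (λ _ → ⊤) ⟩, g , G ⊨ᵈ φ

{-# OPTIONS --safe #-}
module Submission where

open import Data.Empty.Polymorphic using (⊥)
open import Data.Nat using (ℕ; zero; suc)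
open import Data.Product using (_×_; _,_)
open import Data.Unit.Polymorphic using (⊤; tt)
open import Function using (_∘_; id)
open import Level using (Lift; lift)
open import Relation.Binary.PropositionalEquality using (_≡_; refl; cong-app; subst; sym)
open import Relation.Nullary using (¬_)
open import Relation.Nullary.Negation using (contradiction)
open import Relation.Unary using (_⊂_; _⊆_; Empty)
open import Defs

-- The structure with all individuals and all subsets is one of the general ones, which gives the
-- inclusion. Comprehension separates the two notions: among all subsets the diagonal of `P` is a
-- witness, while a family with no closure condition may omit it. One individual then refutes every
-- set that the family does offer.

comprehension : RelSym → Var → Var₂ → Formula
comprehension P x X = ∃² X (∀¹ x (X ⟨ x ⟩ᶠ ↔ᶠ rel P x x))

-- For a variable `n` the test `n ≡ᵇ n` does not reduce; hence the recursion, with `f ∘ suc`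
-- absorbing each successor.
update-same : ∀ {a} {A : Set a} (f : ℕ → A) n (a : A) → (f [ n ← a ]) n ≡ a
update-same f zero    a = refl
update-same f (suc n) a = update-same (f ∘ suc) n a

module _ {ℓ} (U : Set ℓ) where

  general⊆standard : GenerallyValid U ⊆ StandardlyValid U
  general⊆standard valid I g G =
    valid I (λ _ → ⊤) (λ _ → ⊤) (λ _ _ → tt) g (λ _ → tt) G (λ _ → tt)

  comprehension-standard : ∀ P x X → StandardlyValid U (comprehension P x X)
  comprehension-standard P x X I g G = S , tt , λ where
      (d , _ , ¬iff) → ¬iff
        -- Unfolded, each implication denies a doubly negated premise paired with a negated
        -- conclusion, so no excluded middle is needed. Both atoms speak of the same individual;
        -- only the update of `G` has to be evaluated.
        ( (λ (¬¬X , ¬P) → ¬¬X λ (lift s) → ¬P (lift (subst id (X≡S _) s)))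
        , (λ (¬¬P , ¬X) → ¬¬P λ (lift p) → ¬X (lift (subst id (sym (X≡S _)) p))))
    where
    S : Subset U
    S u = I P u u

    X≡S : ∀ u → (G [ X ← S ]) X u ≡ S u
    X≡S = cong-app (update-same G X S)

  -- Countermodel: the only available set is empty, while P holds everywhere.
  comprehension-not-general : U → ∀ P x X → ¬ GenerallyValid U (comprehension P x X)
  comprehension-not-general u P x X valid
    with valid (λ _ _ _ → ⊤) (λ _ → ⊤) (λ S → Lift _ (Empty S))
               -- The family is cut out by emptiness, not by identity with `λ _ → ⊥`, so that it
               -- respects `_≐_`.
               (λ (_ , T⊆S) (lift S-empty) → lift λ v → S-empty v ∘ T⊆S)
               (λ _ → u) (λ _ → tt) (λ _ _ → ⊥) (λ _ → lift λ _ ())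
  ... | S , lift S-empty , all-iff = all-iff (u , tt , λ (_ , P⊃X) →
          -- `P` holds at `u`, which gives its double negation, yet `u` cannot lie in the empty `S`.
          P⊃X ( contradiction (lift tt)
              , λ (lift s) → S-empty _ (subst id (cong-app (update-same _ X S) _) s)))

mainTheorem5 : ∀ {ℓ} (U : Set ℓ) → U →
    (GenerallyValid U ⊂ StandardlyValid U) ×
    ((P : RelSym) (x : Var) (X : Var₂) →
    StandardlyValid U (∃² X (∀¹ x (X ⟨ x ⟩ᶠ ↔ᶠ rel P x x))) ×
    ¬ GenerallyValid U (∃² X (∀¹ x (X ⟨ x ⟩ᶠ ↔ᶠ rel P x x))))
mainTheorem5 U u =
  ( general⊆standard U
  , λ standard⊆general →
      comprehension-not-general U u 0 0 0 (standard⊆general {comprehension 0 0 0} (comprehension-standard U 0 0 0)))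
  , λ P x X → comprehension-standard U P x X , comprehension-not-general U u P x X
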